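{- Let $n\geq 1$. If a simplicial complex $K$ on $I_n$ generates $\mathsf{Mon}_n$, then $K$ contains, as a simplex, an interval of size $\left\lfloor\frac{3n+1}{4}\right\rfloor$.
   Context: For finite sets $A,I$, a language is a subset $L\subseteq A^I$. For finite sets $B,J$ and a function $f:B^J\to A^I$, the input window $\mathcal{W}_f(i)\subseteq J$ of $i\in I$ is the smallest $W\subseteq J$ such that for all $x,y\in B^J$ agreeing on $W$, $f(x)_i=f(y)_i$. The communication complex $K_f$ is the simplicial complex on vertex set $I$ whose simplices are the sets $S\subseteq I$ with $\bigcap_{i\in S}\mathcal{W}_f(i)\neq\emptyset$. A simplicial complex $K$ on $I$ generates $L$ if there exist finite sets $B,J$ and $f:B^J\to A^I$ with $f(B^J)=L$ and $K_f\subseteq K$. $\mathsf{Mon}_n\subseteq\{0,1\}^n$ is the set of binary strings $x_0\ldots x_{n-1}$ that are non-decreasing or non-increasing. Positions $I_n=\{0,\ldots,n-1\}$ are identified with $\mathbb{Z}/n\mathbb{Z}$. For $a,b\in\mathbb{Z}$, the interval $[\![a,b]\!]=\{c\bmod n: c\in\mathbb{Z},\ a\leq c\leq b'\}$ where $b'$ is the representative of $b$ modulo $n$ with $a\leq b'<a+n$; its size is $1+((b-a)\bmod n)$. -}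

module Defs where

open import Data.Nat using (ℕ; zero; suc; _+_; _∸_; _<ᵇ_; _%_)
open import Data.Fin using (Fin; toℕ)
import Data.Fin as F
open import Data.Bool using (Bool; true; false)
import Data.Bool as B
open import Data.Vec using (tabulate)
open import Data.Fin.Subset using (Subset; _∈_; _⊆_)
open import Data.Product using (Σ; ∃; _×_; _,_)
open import Relation.Binary.PropositionalEquality using (_≡_)

-- Positions I_n = Fin n; words over alphabet A are functions Fin n → A.
-- A finite set B of size b is modelled as Fin b; J of size m as Fin m.

record SimplicialComplex (n : ℕ) : Set₁ where
  field
    simplex  : Subset n → Set
    downward : ∀ {S T} → T ⊆ S → simplex S → simplex T
open SimplicialComplex public

NonDecreasing : ∀ {n} → (Fin n → Bool) → Set
NonDecreasing {n} x = ∀ (i j : Fin n) → i F.≤ j → x i B.≤ x j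

NonIncreasing : ∀ {n} → (Fin n → Bool) → Set
NonIncreasing {n} x = ∀ (i j : Fin n) → i F.≤ j → x j B.≤ x i

data Mon (n : ℕ) (x : Fin n → Bool) : Set where
  nondec : NonDecreasing x → Mon n x
  noninc : NonIncreasing x → Mon n x

Determines : ∀ {A : Set} {b m n} → ((Fin m → Fin b) → (Fin n → A)) →
             Fin n → Subset m → Set
Determines f i W = ∀ x y → (∀ j → j ∈ W → x j ≡ y j) → f x i ≡ f y i

IsWindow : ∀ {A : Set} {b m n} → ((Fin m → Fin b) → (Fin n → A)) →
           Fin n → Subset m → Set
IsWindow f i W = Determines f i W × (∀ W' → Determines f i W' → W ⊆ W')

-- Communication complex K_f, given the input windows W i = W_f(i)
CommSimplex : ∀ {m n} → (Fin n → Subset m) → Subset n → Set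
CommSimplex W S = ∃ λ j → ∀ i → i ∈ S → j ∈ W i

record Generates {A : Set} {n : ℕ} (K : SimplicialComplex n)
                 (L : (Fin n → A) → Set) : Set₁ where
  field
    b m     : ℕ
    f       : (Fin m → Fin b) → (Fin n → A)
    image⊆  : ∀ x → L (f x)
    image⊇  : ∀ y → L y → ∃ λ x → ∀ i → f x i ≡ y i
    window  : Fin n → Subset m
    isWindow : ∀ i → IsWindow f i (window i)
    Kf⊆K    : ∀ S → CommSimplex window S → simplex K S

-- The cyclic interval of size k starting at a: {a, a+1, …, a+k-1} mod n,
-- i.e. [[a, a+k-1]] (for 1 ≤ k ≤ n).
interval : ∀ {n} → Fin n → ℕ → Subset n
interval {zero}  a k = tabulate λ ()
interval {suc n} a k = tabulate λ i → ((toℕ i + suc n ∸ toℕ a) % suc n) <ᵇ k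

-- Extend a word w antiperiodically to ℕ (w, ¬ w, w, …): the monotone words become the
-- sequences constant on some [G, G + n), and two equal bits at distance ≤ n force the
-- bits between them. Suppose that every input is free (its window misses some position)
-- on every interval of size k = ⌊(3n+1)/4⌋, and put e = ⌊n/4⌋, h = ⌊n/2⌋.
--
-- Let x i be an input word whose output is constant on [ie, ie + n), with colour
-- alternating in i. Its output at ie + h survives any change of inputs that are free
-- both on [ie, ie + h] and on [ie + h, ie + n) (harmless inputs). By the choice of k
-- every input is harmless for x i or for x (i+1), so x i and x (i+1) can be mixed into
-- M i, which keeps the colour of x i at ie + h and that of x (i+1) at (i+1)e + h.
-- Passing from M i to M (i+1) keeps the bit at (i+1)e + h fixed, and the constant run of
-- M i starting at ie + h grows by at least one with i, for otherwise an interpolation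
-- argument yields an input that is nowhere free on an interval of size n - e ≥ k.
-- For i = e the run reaches (e+1)e + h, where the colour is the opposite one.
module Submission where

open import Defs
open import Data.Nat using (ℕ; zero; suc; _≤_; _<_; _*_; _+_; _∸_; _/_; _%_; _<ᵇ_; s≤s; s≤s⁻¹; NonZero; >-nonZero⁻¹)
open import Data.Nat.Properties hiding (_≟_)
open import Data.Nat.DivMod
open import Data.Nat.Divisibility using (n∣m*n)
open import Data.Nat.Tactic.RingSolver using (solve-∀)
open import Data.Bool as B using (Bool; true; false; not; T; b≤b; f≤t)
open import Data.Bool.Properties using (not-involutive; not-¬; ¬-not; _≟_)
open import Data.Fin using (Fin; toℕ)
open import Data.Fin.Properties using (fromℕ<-cong; toℕ-fromℕ<; toℕ-injective; toℕ<n; any?)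
open import Data.Fin.Patterns
open import Data.Fin.Subset using (_∈_)
open import Data.Fin.Subset.Properties using (_∈?_)
open import Data.Vec.Properties using (lookup∘tabulate; []=⇒lookup)
open import Data.Product using (∃; ∃-syntax; _×_; _,_; proj₁; proj₂)
open import Data.Sum using (_⊎_; inj₁; inj₂; map₂)
open import Data.Empty using (⊥; ⊥-elim)
open import Relation.Nullary using (¬_; Dec; yes; no; contradiction; decidable-stable; from-yes; ¬?)
open import Relation.Binary.PropositionalEquality

⊎-×-distrib : ∀ {P₁ P₂ Q₁ Q₂ : Set} → P₁ ⊎ Q₁ → P₁ ⊎ Q₂ → P₂ ⊎ Q₁ → P₂ ⊎ Q₂ → (P₁ × P₂) ⊎ (Q₁ × Q₂)
⊎-×-distrib (inj₁ p₁) _         (inj₁ p₂) _         = inj₁ (p₁ , p₂)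
⊎-×-distrib (inj₁ p₁) _         (inj₂ q₁) (inj₁ p₂) = inj₁ (p₁ , p₂)
⊎-×-distrib (inj₁ p₁) _         (inj₂ q₁) (inj₂ q₂) = inj₂ (q₁ , q₂)
⊎-×-distrib (inj₂ q₁) (inj₂ q₂) _         _         = inj₂ (q₁ , q₂)
⊎-×-distrib (inj₂ q₁) (inj₁ p₁) _         (inj₁ p₂) = inj₁ (p₁ , p₂)
⊎-×-distrib (inj₂ q₁) (inj₁ p₁) _         (inj₂ q₂) = inj₂ (q₁ , q₂)

-- Antiperiodic bits and the positions where inputs are free

module Twisted
  {J : Set} {B : Set} (n : ℕ)
  (bit : (J → B) → ℕ → Bool)
  (bit-between : ∀ x {t u v c} → t ≤ u → u ≤ v → v ≤ t + n →
                 bit x t ≡ c → bit x v ≡ c → bit x u ≡ c)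
  (bit-shift : ∀ x t → bit x (t + n) ≡ not (bit x t))
  (Free : J → ℕ → Set) (free? : ∀ j t → Dec (Free j t))
  (free-shift : ∀ j t → Free j (t + n) → Free j t)
  (bit-local : ∀ x y t → (∀ j → x j ≡ y j ⊎ Free j t) → bit x t ≡ bit y t)
  where

  Meets : J → ℕ → ℕ → Set
  Meets j lo hi = ∃[ t ] (lo ≤ t × t < hi × Free j t)

  meets-empty : ∀ {j lo hi} → hi ≤ lo → ¬ Meets j lo hi
  meets-empty hi≤lo (t , lo≤t , t<hi , _) = <-irrefl refl (<-≤-trans t<hi (≤-trans hi≤lo lo≤t))

  meets-dropˡ : ∀ {j lo hi} → Meets j lo hi → Free j lo ⊎ Meets j (suc lo) hi
  meets-dropˡ (t , lo≤t , t<hi , f) with m≤n⇒m<n∨m≡n lo≤t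
  ... | inj₁ lo<t = inj₂ (t , lo<t , t<hi , f)
  ... | inj₂ refl = inj₁ f

  meets-dropʳ : ∀ {j lo hi} → Meets j lo (suc hi) → Free j hi ⊎ Meets j lo hi
  meets-dropʳ (t , lo≤t , s≤s t≤hi , f) with m≤n⇒m<n∨m≡n t≤hi
  ... | inj₁ t<hi = inj₂ (t , lo≤t , t<hi , f)
  ... | inj₂ refl = inj₁ f

  -- Going back to `x` on the inputs free at `t` leaves the bit of `y` at `t` alone. An input
  -- allowed to deviate because it is free at `t` thus counts as equal to `x`.
  reset : (x y : J → B) → ℕ → J → B
  reset x y t j with free? j t
  ... | yes _ = x j
  ... | no  _ = y j

  bit-reset : ∀ x y t → bit y t ≡ bit (reset x y t) t
  bit-reset x y t = bit-local y (reset x y t) t agree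
    where
    agree : ∀ j → y j ≡ reset x y t j ⊎ Free j t
    agree j with free? j t
    ... | yes f = inj₂ f
    ... | no  _ = inj₁ refl

  reset-cases : ∀ {P : J → Set} x y t → (∀ j → y j ≡ x j ⊎ Free j t ⊎ P j) →
                ∀ j → reset x y t j ≡ x j ⊎ P j
  reset-cases x y t hyp j with free? j t
  ... | yes _ = inj₁ refl
  ... | no ¬f with hyp j
  ...   | inj₁ eq        = inj₁ eq
  ...   | inj₂ (inj₁ f)  = contradiction f ¬f
  ...   | inj₂ (inj₂ p)  = inj₂ p

  bit-cong : ∀ {x y} t → (∀ j → y j ≡ x j) → bit y t ≡ bit x t
  bit-cong t eq = bit-local _ _ t λ j → inj₁ (eq j)

  -- Stability of a constant run

  ConstantFrom : ℕ → Bool → (J → B) → Set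
  ConstantFrom G c x = ∀ t → G ≤ t → t < G + n → bit x t ≡ c

  -- The double induction enlarges the part [G, l) on the left outermost; for fixed l it
  -- moves i down from the right end.
  robust-step : ∀ {x c G} → ConstantFrom G c x → ∀ p q i y →
    G + p ≤ i → i + suc q ≡ G + n →
    (∀ j → y j ≡ x j ⊎ Free j i ⊎ (Meets j G (G + p) × Meets j (suc i) (G + n))) →
    bit y i ≡ c
  robust-step {x} {c} {G} const p q i y l≤i i+q hyp =
    trans (bit-reset x y i) (go p q l≤i i+q (reset-cases x y i hyp))
    where
    y′ = reset x y i
    i<G+n : ∀ {q} → i + suc q ≡ G + n → i < G + n
    i<G+n eq = ≤-trans (≤-trans (s≤s (m≤m+n i _)) (≤-reflexive (sym (+-suc i _)))) (≤-reflexive eq)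
    done : ∀ p q → G + p ≤ i → i + suc q ≡ G + n → (∀ j → y′ j ≡ x j) → bit y′ i ≡ c
    done p q l≤i i+q eq = trans (bit-cong i eq) (const i (≤-trans (m≤m+n G p) l≤i) (i<G+n i+q))
    go : ∀ p q → G + p ≤ i → i + suc q ≡ G + n →
         (∀ j → y′ j ≡ x j ⊎ (Meets j G (G + p) × Meets j (suc i) (G + n))) → bit y′ i ≡ c
    go zero q l≤i i+q h = done zero q l≤i i+q λ j → case (h j)
      where
      case : ∀ {j} → y′ j ≡ x j ⊎ (Meets j G (G + 0) × Meets j (suc i) (G + n)) → y′ j ≡ x j
      case (inj₁ eq) = eq
      case (inj₂ (m , _)) = contradiction m (meets-empty (≤-reflexive (+-identityʳ G)))
    go (suc p) zero l≤i i+q h = done (suc p) zero l≤i i+q λ j → case (h j)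
      where
      case : ∀ {j} → y′ j ≡ x j ⊎ (Meets j G (G + suc p) × Meets j (suc i) (G + n)) → y′ j ≡ x j
      case (inj₁ eq) = eq
      case (inj₂ (_ , m)) = contradiction m
        (meets-empty (≤-reflexive (trans (sym i+q) (+-comm i 1))))
    go (suc p) (suc q) l≤i i+q h =
      -- Bit `i` is squeezed between `l` and `suc i`. A deviating input is free at `l` or before it,
      -- and free at `suc i` or after it, so the induction applies at both ends.
      bit-between y′ (<⇒≤ l<i) (n≤1+n i) si≤
        (robust-step const p (suc (suc q) + (i ∸ suc l)) l y′ ≤-refl left-eq left)
        (robust-step const (suc p) q (suc i) y′ (m≤n⇒m≤1+n l≤i) (trans (sym (+-suc i (suc q))) i+q) right)
      where
      l = G + p
      l<i : l < i
      l<i = ≤-trans (≤-reflexive (sym (+-suc G p))) l≤i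
      si≤ : suc i ≤ l + n
      si≤ = ≤-trans (i<G+n i+q) (+-monoˡ-≤ n (m≤m+n G p))
      left-eq : l + suc (suc (suc q) + (i ∸ suc l)) ≡ G + n
      left-eq = trans (lemma l q (i ∸ suc l))
                 (trans (cong (_+ suc (suc q)) (m+[n∸m]≡n l<i)) i+q)
        where
        lemma : ∀ l q d → l + suc (suc (suc q) + d) ≡ suc l + d + suc (suc q)
        lemma = solve-∀
      left : ∀ j → y′ j ≡ x j ⊎ Free j l ⊎ (Meets j G l × Meets j (suc l) (G + n))
      left j with h j
      ... | inj₁ eq = inj₁ eq
      ... | inj₂ (m₁ , (t , i<t , t< , f)) with meets-dropʳ (subst (Meets j G) (+-suc G p) m₁)
      ...   | inj₁ f′ = inj₂ (inj₁ f′)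
      ...   | inj₂ m  = inj₂ (inj₂ (m , (t , <-trans l<i i<t , t< , f)))
      right : ∀ j → y′ j ≡ x j ⊎ Free j (suc i) ⊎ (Meets j G (G + suc p) × Meets j (suc (suc i)) (G + n))
      right j with h j
      ... | inj₁ eq = inj₁ eq
      ... | inj₂ (m₁ , m₂) = inj₂ (map₂ (m₁ ,_) (meets-dropˡ m₂))

  -- An input free on both closed sides of `i` is free at `i` itself or strictly on both sides,
  -- which is what `robust-step` asks for with left part `[G, i)`.
  robust : ∀ {x c G} → ConstantFrom G c x → ∀ i y → G ≤ i → i < G + n →
    (∀ j → y j ≡ x j ⊎ (Meets j G (suc i) × Meets j i (G + n))) → bit y i ≡ c
  robust {x} {c} {G} const i y G≤i i<G+n hyp =
    robust-step const (i ∸ G) (G + n ∸ suc i) i y (≤-reflexive i≡)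
      (trans (+-suc i _) (m+[n∸m]≡n i<G+n)) cases
    where
    i≡ : G + (i ∸ G) ≡ i
    i≡ = m+[n∸m]≡n G≤i
    cases : ∀ j → y j ≡ x j ⊎ Free j i ⊎ (Meets j G (G + (i ∸ G)) × Meets j (suc i) (G + n))
    cases j with hyp j
    ... | inj₁ eq = inj₁ eq
    ... | inj₂ (m₁ , m₂) with meets-dropʳ m₁ | meets-dropˡ m₂
    ...   | inj₁ f  | _       = inj₂ (inj₁ f)
    ...   | inj₂ _  | inj₁ f  = inj₂ (inj₁ f)
    ...   | inj₂ m₁′ | inj₂ m₂′ = inj₂ (inj₂ (subst (Meets j G) (sym i≡) m₁′ , m₂′))

  -- Interpolation between two input words

  Mix : (x x′ y : J → B) → Set
  Mix x x′ y = ∀ j → y j ≡ x j ⊎ y j ≡ x′ j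

  -- Craig interpolation: the run of c ending at i + q is carried leftwards, the input
  -- becoming arbitrary wherever it has been free.
  interpolate-step : ∀ {x x′ b c} → (∀ y → Mix x x′ y → bit y b ≡ c) →
    ∀ q i y → b ≤ i → i + q < b + n → bit x (i + q) ≡ c → Mix x x′ y →
    (∀ j → y j ≡ x j ⊎ Meets j i (suc (i + q))) → bit y i ≡ c
  interpolate-step {x} {x′} {b} {c} fixed q i y b≤i i+q< end mix hyp =
    trans (bit-reset x y i)
      (go q i+q< end (reset-cases x y i λ j → map₂ meets-dropˡ (hyp j)))
    where
    y′ = reset x y i
    mix′ : Mix x x′ y′
    mix′ j with free? j i
    ... | yes _ = inj₁ refl
    ... | no  _ = mix j
    go : ∀ q → i + q < b + n → bit x (i + q) ≡ c →
         (∀ j → y′ j ≡ x j ⊎ Meets j (suc i) (suc (i + q))) → bit y′ i ≡ c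
    go zero _ end h = trans (bit-cong i λ j → case (h j)) (subst (λ s → bit x s ≡ c) (+-identityʳ i) end)
      where
      case : ∀ {j} → y′ j ≡ x j ⊎ Meets j (suc i) (suc (i + 0)) → y′ j ≡ x j
      case (inj₁ eq) = eq
      case (inj₂ m)  = contradiction m (meets-empty (s≤s (≤-reflexive (+-identityʳ i))))
    go (suc q) i+q< end h =
      -- The mixture `y′` has colour `c` at the anchor `b` by `fixed` and at `suc i` by induction,
      -- hence also at `i` between them.
      bit-between y′ b≤i (n≤1+n i)
        (≤-trans (s≤s (m≤m+n i q)) (≤-trans (≤-reflexive (sym (+-suc i q))) (<⇒≤ i+q<)))
        (fixed y′ mix′)
        (interpolate-step fixed q (suc i) y′ (m≤n⇒m≤1+n b≤i) (subst (_< b + n) (+-suc i q) i+q<)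
          (subst (λ s → bit x s ≡ c) (+-suc i q) end) mix′
          (λ j → map₂ (subst (λ s → Meets j (suc i) (suc s)) (+-suc i q)) (h j)))

  -- Since every input is free somewhere on `[i, q]`, the word reached at `i` may be `x′` itself.
  interpolate : ∀ {x x′ b c} → (∀ y → Mix x x′ y → bit y b ≡ c) →
    ∀ i q → b ≤ i → i ≤ q → q < b + n → bit x q ≡ c →
    (∀ j → Meets j i (suc q)) → bit x′ i ≡ c
  interpolate {x′ = x′} {b} {c} fixed i q b≤i i≤q q< end hyp =
    interpolate-step fixed (q ∸ i) i x′ b≤i (subst (_< b + n) (sym q≡) q<)
      (subst (λ s → bit _ s ≡ c) (sym q≡) end) (λ _ → inj₂ refl)
      (λ j → inj₂ (subst (λ s → Meets j i (suc s)) (sym q≡) (hyp j)))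
    where
    q≡ : i + (q ∸ i) ≡ q
    q≡ = m+[n∸m]≡n i≤q

  -- The chain of mixed input words

  module Chain
    (constant : ∀ G c → ∃[ x ] ConstantFrom G c x)
    (e h k : ℕ) (e<n : e < n) (e≤h : e ≤ h) (h+e≤n : h + e ≤ n) (h<n : h < n)
    (k≤h+e : k ≤ suc (h + e)) (k+e≤n : k + e ≤ n) (k+h≤n+e : k + h ≤ n + e)
    (hit : ∀ j a → Meets j a (a + k))
    where

    hit-within : ∀ j {lo hi} → lo + k ≤ hi → Meets j lo hi
    hit-within j {lo} le with hit j lo
    ... | t , lo≤t , t< , f = t , lo≤t , <-≤-trans t< le , f

    g a : ℕ → ℕ
    g i = i * e
    a i = g i + h

    colour : ℕ → Bool
    colour zero    = true
    colour (suc i) = not (colour i)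

    x : ℕ → J → B
    x i = proj₁ (constant (g i) (colour i))

    Harmless : ℕ → J → Set
    Harmless i j = Meets j (g i) (suc (a i)) × Meets j (a i) (g i + n)

    -- By distributivity it suffices to pair each interval of `Harmless i` with each of
    -- `Harmless (suc i)`. Modulo `n`, every such pair covers `k` consecutive positions, and `hit`
    -- makes `j` free at one of them.
    harmless : ∀ i j → Harmless i j ⊎ Harmless (suc i) j
    harmless i j = ⊎-×-distrib join₁₁ join₁₂ join₂₁ join₂₂
      where
      G = g i
      A = a i
      join₁₁ : Meets j G (suc A) ⊎ Meets j (e + G) (suc (e + G + h))
      join₁₁ with hit-within j {G} {suc (e + G + h)} (≤-trans (+-monoʳ-≤ G k≤h+e) (≤-reflexive (eq G h e)))
        where
        eq : ∀ G h e → G + suc (h + e) ≡ suc (e + G + h)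
        eq = solve-∀
      ... | t , lo , hi , f with ≤-<-connex t A
      ...   | inj₁ t≤A = inj₁ (t , lo , s≤s t≤A , f)
      ...   | inj₂ A<t = inj₂ (t , ≤-trans (≤-trans (≤-reflexive (+-comm e G)) (+-monoʳ-≤ G e≤h)) (<⇒≤ A<t) , hi , f)
      join₁₂ : Meets j G (suc A) ⊎ Meets j (e + G + h) (e + G + n)
      join₁₂ with hit-within j {e + G + h} {suc (A + n)}
                    (≤-trans (≤-reflexive (eq e G h k)) (m≤n⇒m≤1+n (+-monoʳ-≤ A k+e≤n)))
        where
        eq : ∀ e G h k → e + G + h + k ≡ G + h + (k + e)
        eq = solve-∀
      ... | t , lo , s≤s hi , f with <-≤-connex t (e + G + n)
      ...   | inj₁ t< = inj₂ (t , lo , t< , f)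
      -- This pair is joined across the period: `[G, A]` moved up by `n` continues the second
      -- interval as far as `A + n`.
      ...   | inj₂ ≤t = inj₁ (t ∸ n , G≤ , s≤s (m≤n+o⇒m∸n≤o t n (≤-trans hi (≤-reflexive (+-comm A n)))) , free-shift j (t ∸ n) (subst (Free j) (sym (m∸n+n≡m n≤t)) f))
        where
        n≤t : n ≤ t
        n≤t = ≤-trans (m≤n+m n (e + G)) ≤t
        G≤ : G ≤ t ∸ n
        G≤ = ≤-trans (m≤n+m G e) (m+n≤o⇒m≤o∸n (e + G) {n} ≤t)
      join₂₁ : Meets j A (G + n) ⊎ Meets j (e + G) (suc (e + G + h))
      join₂₁ with hit-within j {e + G} {G + n} (≤-trans (≤-reflexive (eq e G k)) (+-monoʳ-≤ G k+e≤n))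
        where
        eq : ∀ e G k → e + G + k ≡ G + (k + e)
        eq = solve-∀
      ... | t , lo , hi , f with ≤-<-connex A t
      ...   | inj₁ A≤t = inj₁ (t , A≤t , hi , f)
      ...   | inj₂ t<A = inj₂ (t , lo , ≤-trans t<A (m≤n⇒m≤1+n (+-monoˡ-≤ h (m≤n+m G e))) , f)
      join₂₂ : Meets j A (G + n) ⊎ Meets j (e + G + h) (e + G + n)
      join₂₂ with hit-within j {A} {e + G + n}
                    (≤-trans (≤-reflexive (eq₁ G h k)) (≤-trans (+-monoʳ-≤ G k+h≤n+e) (≤-reflexive (eq₂ G n e))))
        where
        eq₁ : ∀ G h k → G + h + k ≡ G + (k + h)
        eq₁ = solve-∀
        eq₂ : ∀ G n e → G + (n + e) ≡ e + G + n
        eq₂ = solve-∀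
      ... | t , lo , hi , f with <-≤-connex t (G + n)
      ...   | inj₁ t< = inj₁ (t , lo , t< , f)
      ...   | inj₂ ≤t = inj₂ (t , ≤-trans (≤-trans (≤-reflexive (eq e G h)) (+-monoʳ-≤ G h+e≤n)) ≤t , hi , f)
        where
        eq : ∀ e G h → e + G + h ≡ G + (h + e)
        eq = solve-∀

    -- The choice is crosswise: an input harmless for `x i` follows `x (suc i)`. So `M i` deviates
    -- from either word only at inputs harmless for that word.
    M : ℕ → J → B
    M i j with harmless i j
    ... | inj₁ _ = x (suc i) j
    ... | inj₂ _ = x i j

    g≤a : ∀ i → g i ≤ a i
    g≤a i = m≤m+n (g i) h

    a<g+n : ∀ i → a i < g i + n
    a<g+n i = +-monoʳ-< (g i) h<n

    M-cur : ∀ i j → M i j ≡ x i j ⊎ Harmless i j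
    M-cur i j with harmless i j
    ... | inj₁ hl = inj₂ hl
    ... | inj₂ _  = inj₁ refl

    M-next : ∀ i j → M i j ≡ x (suc i) j ⊎ Harmless (suc i) j
    M-next i j with harmless i j
    ... | inj₁ _  = inj₁ refl
    ... | inj₂ hl = inj₂ hl

    fixed : ∀ i y → (∀ j → y j ≡ x i j ⊎ Harmless i j) → bit y (a i) ≡ colour i
    fixed i y = robust (proj₂ (constant (g i) (colour i))) (a i) y (g≤a i) (a<g+n i)

    -- Both `M i` and `M (suc i)` deviate from `x (suc i)` only at inputs harmless for it. This is a
    -- condition on single inputs, so mixtures inherit it.
    mix-fixed : ∀ i y → Mix (M i) (M (suc i)) y → bit y (a (suc i)) ≡ colour (suc i)
    mix-fixed i y mix = fixed (suc i) y agree
      where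
      agree : ∀ j → y j ≡ x (suc i) j ⊎ Harmless (suc i) j
      agree j with mix j
      ... | inj₁ eq = subst (λ v → v ≡ x (suc i) j ⊎ Harmless (suc i) j) (sym eq) (M-next i j)
      ... | inj₂ eq = subst (λ v → v ≡ x (suc i) j ⊎ Harmless (suc i) j) (sym eq) (M-cur (suc i) j)

    advance : ∀ i → i ≤ e → bit (M i) (a i + i) ≡ colour i
    advance zero _ = subst (λ s → bit (M 0) s ≡ true) (sym (+-identityʳ h)) (fixed 0 (M 0) (M-cur 0))
    -- The far end lies one period after `a i + i`, where antiperiodicity turns `colour i` into
    -- `colour (suc i)`. It is within distance `n` of the anchor `a (suc i)` because `i < e`, and
    -- the interval crossed has `n - e` positions.
    advance (suc i) i<e = interpolate (mix-fixed i) (a (suc i) + suc i) (a i + i + n)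
      (m≤m+n (a (suc i)) (suc i)) start≤end end<
      (trans (bit-shift (M i) (a i + i)) (cong not (advance i (<⇒≤ i<e))))
      (λ j → hit-within j long-enough)
      where
      start≤end : a (suc i) + suc i ≤ a i + i + n
      start≤end = ≤-trans (≤-reflexive (eq e (g i) h i)) (+-monoʳ-≤ (a i + i) e<n)
        where
        eq : ∀ e G h i → e + G + h + suc i ≡ G + h + i + suc e
        eq = solve-∀
      end< : a i + i + n < a (suc i) + n
      end< = +-monoˡ-< n (≤-trans (+-monoʳ-< (a i) i<e) (≤-reflexive (eq e (g i) h)))
        where
        eq : ∀ e G h → G + h + e ≡ e + G + h
        eq = solve-∀
      long-enough : a (suc i) + suc i + k ≤ suc (a i + i + n)
      long-enough = ≤-trans (≤-reflexive (eq e (g i) h i k)) (s≤s (+-monoʳ-≤ (a i + i) k+e≤n))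
        where
        eq : ∀ e G h i k → e + G + h + suc i + k ≡ suc (G + h + i + (k + e))
        eq = solve-∀

    impossible : ⊥
    -- The positions `a e + e` and `a (suc e)` coincide.
    impossible = not-¬ (advance e ≤-refl)
      (trans (cong (bit (M e)) (eq (g e) h e)) (fixed (suc e) (M e) (M-next e)))
      where
      eq : ∀ G h e → G + h + e ≡ e + G + h
      eq = solve-∀

-- Antiperiodic extension of monotone words

flip : ℕ → Bool → Bool
flip zero    c = c
flip (suc q) c = not (flip q c)

squeeze : ∀ {p q r c} → p B.≤ q → q B.≤ r → p ≡ c → r ≡ c → q ≡ c
squeeze b≤b _   p≡c _   = p≡c
squeeze f≤t b≤b _   r≡c = r≡c

Mon-between : ∀ {n} {w : Fin n → Bool} {i j l c} → Mon n w →
              toℕ i ≤ toℕ j → toℕ j ≤ toℕ l → w i ≡ c → w l ≡ c → w j ≡ c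
Mon-between (nondec mono) i≤j j≤l wi wl = squeeze (mono _ _ i≤j) (mono _ _ j≤l) wi wl
Mon-between (noninc anti) i≤j j≤l wi wl = squeeze (anti _ _ j≤l) (anti _ _ i≤j) wl wi

module Antiperiodic (n : ℕ) .{{_ : NonZero n}} where

  mod-shift : ∀ t → (t + n) mod n ≡ t mod n
  mod-shift t = fromℕ<-cong _ _ ([m+n]%n≡m%n t n) _ _

  twist : (Fin n → Bool) → ℕ → Bool
  twist w t = flip (t / n) (w (t mod n))

  twist-shift : ∀ w t → twist w (t + n) ≡ not (twist w t)
  twist-shift w t = cong₂ (λ q i → flip q (w i))
    (trans (m/n≡1+[m∸n]/n (m≤n+m n t)) (cong (λ s → suc (s / n)) (m+n∸n≡m t n)))
    (mod-shift t)

  twist-low : ∀ w {t} → t < n → twist w t ≡ w (t mod n)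
  twist-low w {t} t<n = cong (λ q → flip q (w (t mod n))) (m<n⇒m/n≡0 t<n)

  toℕ-mod : ∀ {t} → t < n → toℕ (t mod n) ≡ t
  toℕ-mod t<n = trans (toℕ-fromℕ< _) (m<n⇒m%n≡m t<n)

  unshift : ∀ {t} → n ≤ t → ∃[ s ] t ≡ s + n
  unshift {t} n≤t = t ∸ n , sym (m∸n+n≡m n≤t)

  module _ {w : Fin n → Bool} (mon : Mon n w) where

    between-low : ∀ {t u v c} → t ≤ u → u ≤ v → v < n →
                  twist w t ≡ c → twist w v ≡ c → twist w u ≡ c
    between-low {t} {u} {v} t≤u u≤v v<n wt wv =
      trans (twist-low w u<n)
        (Mon-between mon
          (subst₂ _≤_ (sym (toℕ-mod t<n)) (sym (toℕ-mod u<n)) t≤u)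
          (subst₂ _≤_ (sym (toℕ-mod u<n)) (sym (toℕ-mod v<n)) u≤v)
          (trans (sym (twist-low w t<n)) wt)
          (trans (sym (twist-low w v<n)) wv))
      where
      u<n = ≤-<-trans u≤v v<n
      t<n = ≤-<-trans t≤u u<n

    -- A monotone word turns at most once: `not c` at `v` would force `not c` at `u`.
    turn-after : ∀ {t u v c} → t ≤ u → u ≤ v → v < n →
                 twist w t ≡ not c → twist w u ≡ c → twist w v ≡ c
    turn-after {v = v} {c} t≤u u≤v v<n wt wu = decidable-stable (twist w v ≟ c) λ wv≢c →
      not-¬ wu (between-low t≤u u≤v v<n wt (¬-not wv≢c))

    turn-before : ∀ {t u v c} → t ≤ u → u ≤ v → v < n →
                  twist w u ≡ not c → twist w v ≡ c → twist w t ≡ not c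
    turn-before {t} {c = c} t≤u u≤v v<n wu wv = decidable-stable (twist w t ≟ not c) λ wt≢¬c →
      not-¬ (between-low t≤u u≤v v<n (trans (¬-not wt≢¬c) (not-involutive c)) wv) wu

    twist-back : ∀ {t c} → twist w (t + n) ≡ c → twist w t ≡ not c
    twist-back {t} wt+n = trans (sym (not-involutive _)) (cong not (trans (sym (twist-shift w t)) wt+n))

    -- If `v = v′ + n`, then `v′ ≤ t` carries the opposite bit. The only turn of `w` lies between
    -- `v′` and `t`, so `w` is constant up to `v′` and from `t` on.
    between-first : ∀ {t u v c} → t < n → t ≤ u → u ≤ v → v ≤ t + n →
                    twist w t ≡ c → twist w v ≡ c → twist w u ≡ c
    between-first {t} {u} {v} t<n t≤u u≤v v≤ wt wv with <-≤-connex v n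
    ... | inj₁ v<n = between-low t≤u u≤v v<n wt wv
    ... | inj₂ n≤v with unshift n≤v
    ...   | v′ , refl with <-≤-connex u n
    ...     | inj₁ u<n = turn-after (+-cancelʳ-≤ n v′ t v≤) t≤u u<n (twist-back wv) wt
    ...     | inj₂ n≤u with unshift n≤u
    ...       | u′ , refl = trans (twist-shift w u′)
                  (trans (cong not (turn-before (+-cancelʳ-≤ n u′ v′ u≤v) (+-cancelʳ-≤ n v′ t v≤) t<n (twist-back wv) wt))
                         (not-involutive _))

    twist-between : ∀ {t u v c} → t ≤ u → u ≤ v → v ≤ t + n →
                    twist w t ≡ c → twist w v ≡ c → twist w u ≡ c
    twist-between {t} = go (suc t) ≤-refl
      where
      -- The fuel bounds `t`; each round lowers all three positions by `n` and negates `c`.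
      go : ∀ fuel {t u v c} → t < fuel → t ≤ u → u ≤ v → v ≤ t + n →
           twist w t ≡ c → twist w v ≡ c → twist w u ≡ c
      go (suc fuel) {t} {u} {v} t<fuel t≤u u≤v v≤ wt wv with <-≤-connex t n
      ... | inj₁ t<n = between-first t<n t≤u u≤v v≤ wt wv
      ... | inj₂ n≤t with unshift n≤t | unshift (≤-trans n≤t t≤u) | unshift (≤-trans n≤t (≤-trans t≤u u≤v))
      ...   | t′ , refl | u′ , refl | v′ , refl = trans (twist-shift w u′) (trans (cong not
              (go fuel (<-≤-trans (m<m+n t′ (>-nonZero⁻¹ n)) (s≤s⁻¹ t<fuel))
                (+-cancelʳ-≤ n t′ u′ t≤u) (+-cancelʳ-≤ n u′ v′ u≤v) (+-cancelʳ-≤ n v′ (t′ + n) v≤)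
                (twist-back wt) (twist-back wv)))
              (not-involutive _))

  -- Words constant on a prescribed period

  step : Bool → ℕ → Fin n → Bool
  step c G i with toℕ i <? G
  ... | yes _ = not c
  ... | no  _ = c

  step-Mon : ∀ c G → Mon n (step c G)
  step-Mon true G = nondec mono
    where
    mono : NonDecreasing (step true G)
    mono i j i≤j with toℕ i <? G | toℕ j <? G
    ... | yes _   | yes _   = b≤b
    ... | yes _   | no  _   = f≤t
    ... | no  _   | no  _   = b≤b
    ... | no  i≮G | yes j<G = contradiction (≤-<-trans i≤j j<G) i≮G
  step-Mon false G = noninc anti
    where
    anti : NonIncreasing (step false G)
    anti i j i≤j with toℕ i <? G | toℕ j <? G
    ... | yes _   | yes _   = b≤b
    ... | yes _   | no  _   = f≤t
    ... | no  _   | no  _   = b≤b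
    ... | no  i≮G | yes j<G = contradiction (≤-<-trans i≤j j<G) i≮G

  twist-step-below : ∀ c {G t} → t < n → t < G → twist (step c G) t ≡ not c
  twist-step-below c {G} {t} t<n t<G = trans (twist-low (step c G) t<n) below
    where
    below : step c G (t mod n) ≡ not c
    below with toℕ (t mod n) <? G
    ... | yes _ = refl
    ... | no ≮G = contradiction (subst (_< G) (sym (toℕ-mod t<n)) t<G) ≮G

  twist-step-above : ∀ c {G t} → t < n → G ≤ t → twist (step c G) t ≡ c
  twist-step-above c {G} {t} t<n G≤t = trans (twist-low (step c G) t<n) above
    where
    above : step c G (t mod n) ≡ c
    above with toℕ (t mod n) <? G
    ... | yes <G = contradiction (≤-trans <G G≤t) (<-irrefl (toℕ-mod t<n))
    ... | no _ = refl

  -- For `G < n` the step word has `c` from `G` on, and its initial `not c` is negated back to `c`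
  -- on `[n, G + n)`. A larger `G` is lowered by `n` with the opposite colour.
  constant-word : ∀ G c → ∃[ w ] (Mon n w × (∀ t → G ≤ t → t < G + n → twist w t ≡ c))
  constant-word G = go (suc G) ≤-refl
    where
    go : ∀ fuel {G} → G < fuel → ∀ c →
         ∃[ w ] (Mon n w × (∀ t → G ≤ t → t < G + n → twist w t ≡ c))
    go (suc fuel) {G} G<fuel c with <-≤-connex G n
    ... | inj₁ G<n = step c G , step-Mon c G , constant
      where
      constant : ∀ t → G ≤ t → t < G + n → twist (step c G) t ≡ c
      constant t G≤t t< with <-≤-connex t n
      ... | inj₁ t<n = twist-step-above c t<n G≤t
      ... | inj₂ n≤t with unshift n≤t
      ...   | s , refl = trans (twist-shift (step c G) s)
                (trans (cong not (twist-step-below c (<-trans s<G G<n) s<G)) (not-involutive c))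
        where
        s<G : s < G
        s<G = +-cancelʳ-< n s G t<
    ... | inj₂ n≤G with unshift n≤G
    ...   | G′ , refl with go fuel (<-≤-trans (m<m+n G′ (>-nonZero⁻¹ n)) (s≤s⁻¹ G<fuel)) (not c)
    ...     | w , mon , const = w , mon , constant
      where
      constant : ∀ t → G′ + n ≤ t → t < G′ + n + n → twist w t ≡ c
      constant t G≤t t< with unshift (≤-trans n≤G G≤t)
      ... | s , refl = trans (twist-shift w s)
              (trans (cong not (const s (+-cancelʳ-≤ n G′ s G≤t) (+-cancelʳ-< n s (G′ + n) t<))) (not-involutive c))

-- Arithmetic of the rounded sizes

div-shift : ∀ r q d .{{_ : NonZero d}} → (r + q * d) / d ≡ r / d + q
div-shift r q d = trans (+-distrib-/-∣ʳ r (n∣m*n q)) (cong (r / d +_) (m*n/n≡m q d))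

-- The multiples of `q` cancel or leave slack in every inequality, so only conditions on the
-- remainder `r` are left.
quarter-arithmetic : ∀ r q {h₀ k₀} → k₀ ≤ suc h₀ → k₀ + h₀ ≤ r →
  let n = r + q * 4 ; h = h₀ + q * 2 ; k = k₀ + 3 * q in
  q ≤ h × h + q ≤ n × k ≤ suc (h + q) × k + q ≤ n × k + h ≤ n + q
quarter-arithmetic r q {h₀} {k₀} k₀≤ k₀+h₀≤ =
    ≤-trans (m≤m*n q 2) (m≤n+m (q * 2) h₀)
  , ≤-trans (≤-trans (≤-reflexive (eq₁ h₀ q)) (m≤m+n _ q))
            (≤-trans (≤-reflexive (eq₂ h₀ q)) (+-monoˡ-≤ (q * 4) (m+n≤o⇒n≤o k₀ k₀+h₀≤)))
  , ≤-trans (+-monoˡ-≤ (3 * q) k₀≤) (≤-reflexive (eq₃ h₀ q))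
  , ≤-trans (≤-reflexive (eq₄ k₀ q)) (+-monoˡ-≤ (q * 4) (m+n≤o⇒m≤o k₀ k₀+h₀≤))
  , ≤-trans (≤-reflexive (eq₅ k₀ h₀ q)) (≤-trans (+-monoˡ-≤ (q * 4 + q) k₀+h₀≤) (≤-reflexive (sym (+-assoc r (q * 4) q))))
  where
  eq₁ : ∀ h q → h + q * 2 + q ≡ h + q * 3
  eq₁ = solve-∀
  eq₂ : ∀ h q → h + q * 3 + q ≡ h + q * 4
  eq₂ = solve-∀
  eq₃ : ∀ h q → suc h + 3 * q ≡ suc (h + q * 2 + q)
  eq₃ = solve-∀
  eq₄ : ∀ k q → k + 3 * q + q ≡ k + q * 4
  eq₄ = solve-∀
  eq₅ : ∀ k h q → k + 3 * q + (h + q * 2) ≡ k + h + (q * 4 + q)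
  eq₅ = solve-∀

floor-arithmetic : ∀ n → let e = n / 4 ; h = n / 2 ; k = (3 * n + 1) / 4 in
  e ≤ h × h + e ≤ n × k ≤ suc (h + e) × k + e ≤ n × k + h ≤ n + e
floor-arithmetic n with n divMod 4
... | result q r refl = subst₂
        (λ e h → e ≤ h × h + e ≤ n × k ≤ suc (h + e) × k + e ≤ n × k + h ≤ n + e)
        (sym (trans (div-shift (toℕ r) q 4) (cong (_+ q) (m<n⇒m/n≡0 (toℕ<n r)))))
        (sym (trans (cong (λ s → (toℕ r + s) / 2) (sym (*-assoc q 2 2))) (div-shift (toℕ r) (q * 2) 2)))
        (subst (λ k → q ≤ h × h + q ≤ n × k ≤ suc (h + q) × k + q ≤ n × k + h ≤ n + q)
          (sym (trans (cong (_/ 4) (eq (toℕ r) q)) (div-shift (3 * toℕ r + 1) (3 * q) 4)))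
          (quarter-arithmetic (toℕ r) q (proj₁ (small r)) (proj₂ (small r))))
  where
  k = (3 * n + 1) / 4
  h = toℕ r / 2 + q * 2
  eq : ∀ r q → 3 * (r + q * 4) + 1 ≡ 3 * r + 1 + 3 * q * 4
  eq = solve-∀
  -- In all four cases `k₀ + h₀` equals `r`, so `k + h = n + e` for every `n`: with these `e` and
  -- `h`, no larger `k` satisfies the last inequality.
  small : ∀ (r : Fin 4) → let h₀ = toℕ r / 2 ; k₀ = (3 * toℕ r + 1) / 4 in k₀ ≤ suc h₀ × k₀ + h₀ ≤ toℕ r
  small 0F = from-yes (0 ≤? 1) , from-yes (0 ≤? 0)
  small 1F = from-yes (1 ≤? 1) , from-yes (1 ≤? 1)
  small 2F = from-yes (1 ≤? 2) , from-yes (2 ≤? 2)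
  small 3F = from-yes (2 ≤? 2) , from-yes (3 ≤? 3)

-- Cyclic intervals as offsets from their start

interval-step : ∀ {n} (a : Fin (suc n)) {k i} → i ∈ interval a k →
  ∃[ d ] (d < k × i ≡ (toℕ a + d) mod suc n)
interval-step {n} a {k} {i} i∈ = d , <ᵇ⇒< d k (subst T (sym eq) _) , toℕ-injective (sym position)
  where
  d = (toℕ i + suc n ∸ toℕ a) % suc n
  eq : (d <ᵇ k) ≡ true
  eq = trans (sym (lookup∘tabulate (λ i → (toℕ i + suc n ∸ toℕ a) % suc n <ᵇ k) i)) ([]=⇒lookup i∈)
  -- The added period makes the truncated subtraction exact.
  a≤ : toℕ a ≤ toℕ i + suc n
  a≤ = ≤-trans (<⇒≤ (toℕ<n a)) (m≤n+m (suc n) (toℕ i))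
  position : toℕ ((toℕ a + d) mod suc n) ≡ toℕ i
  position = begin
    toℕ ((toℕ a + d) mod suc n)                      ≡⟨ toℕ-fromℕ< _ ⟩
    (toℕ a + d) % suc n                              ≡⟨ %-distribˡ-+ (toℕ a) d (suc n) ⟩
    (toℕ a % suc n + d % suc n) % suc n              ≡⟨ cong (λ s → (toℕ a % suc n + s) % suc n) (m%n%n≡m%n (toℕ i + suc n ∸ toℕ a) (suc n)) ⟩
    (toℕ a % suc n + d) % suc n                      ≡⟨ %-distribˡ-+ (toℕ a) (toℕ i + suc n ∸ toℕ a) (suc n) ⟨
    (toℕ a + (toℕ i + suc n ∸ toℕ a)) % suc n        ≡⟨ cong (_% suc n) (m+[n∸m]≡n a≤) ⟩
    (toℕ i + suc n) % suc n                          ≡⟨ [m+n]%n≡m%n (toℕ i) (suc n) ⟩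
    toℕ i % suc n                                    ≡⟨ m<n⇒m%n≡m (toℕ<n i) ⟩
    toℕ i                                            ∎
    where open ≡-Reasoning

-- Application to the communication complex

theorem7p4 : (n : ℕ) → 1 ≤ n → (K : SimplicialComplex n) →
    Generates K (Mon n) →
    ∃ λ (a : Fin n) → simplex K (interval a ((3 * n + 1) / 4))
-- A finite search decides whether some input lies in all windows of an interval of size `k`. Such
-- an input witnesses the simplex; its absence supplies `hit` and contradicts the chain.
theorem7p4 n@(suc n-1) 1≤n K gen = conclude (any? λ j → any? λ a → full? j (toℕ a))
  where
  open Generates gen
  open Antiperiodic n

  k = (3 * n + 1) / 4

  Full : Fin m → ℕ → Set
  Full j a = ∀ {d} → d < k → j ∈ window ((a + d) mod n)

  full? : ∀ j a → Dec (Full j a)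
  full? j a = allUpTo? (λ d → j ∈? window ((a + d) mod n)) k

  Free : Fin m → ℕ → Set
  Free j t = ¬ (j ∈ window (t mod n))

  free? : ∀ j t → Dec (Free j t)
  free? j t = ¬? (j ∈? window (t mod n))

  bit : (Fin m → Fin b) → ℕ → Bool
  bit x = twist (f x)

  bit-local : ∀ x y t → (∀ j → x j ≡ y j ⊎ Free j t) → bit x t ≡ bit y t
  bit-local x y t agree = cong (flip (t / n)) (proj₁ (isWindow (t mod n)) x y onWindow)
    where
    onWindow : ∀ j → j ∈ window (t mod n) → x j ≡ y j
    onWindow j j∈ with agree j
    ... | inj₁ eq   = eq
    ... | inj₂ free = contradiction j∈ free

  free-shift : ∀ j t → Free j (t + n) → Free j t
  free-shift j t = subst (λ i → ¬ (j ∈ window i)) (mod-shift t)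

  open Twisted n bit (λ x → twist-between (image⊆ x)) (λ x → twist-shift (f x))
    Free free? free-shift bit-local

  constant : ∀ G c → ∃[ x ] ConstantFrom G c x
  constant G c with constant-word G c
  ... | w , mon , const with image⊇ w mon
  ...   | x , fx≡w = x , λ t G≤t t< → trans (cong (flip (t / n)) (fx≡w (t mod n))) (const t G≤t t<)

  not-full : ∀ {j a} → ¬ Full j a → Meets j a (a + k)
  not-full {j} {a} ¬full with anyUpTo? (λ d → free? j (a + d)) k
  ... | yes (d , d<k , free) = a + d , m≤m+n a d , +-monoʳ-< a d<k , free
  ... | no none = contradiction
    (λ {d} d<k → decidable-stable (j ∈? window ((a + d) mod n)) λ free → none (d , d<k , free)) ¬full

  hit : (∀ j (a : Fin n) → ¬ Full j (toℕ a)) → ∀ j a → Meets j a (a + k)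
  -- Starts range over all naturals in the chain, so `a` is reduced to its residue.
  hit none j a = not-full λ full → none j (a mod n) λ {d} d<k →
    subst (λ i → j ∈ window i) (fromℕ<-cong _ _ (reduce d) _ _) (full d<k)
    where
    reduce : ∀ d → (a + d) % n ≡ (toℕ (a mod n) + d) % n
    reduce d = begin
      (a + d) % n                   ≡⟨ %-distribˡ-+ a d n ⟩
      (a % n + d % n) % n           ≡⟨ cong (λ s → (s + d % n) % n) (m%n%n≡m%n a n) ⟨
      (a % n % n + d % n) % n       ≡⟨ %-distribˡ-+ (a % n) d n ⟨
      (a % n + d) % n               ≡⟨ cong (λ s → (s + d) % n) (toℕ-fromℕ< (m%n<n a n)) ⟨
      (toℕ (a mod n) + d) % n       ∎
      where open ≡-Reasoning

  conclude : Dec (∃[ j ] ∃[ a ] Full j (toℕ a)) → ∃ λ (a : Fin n) → simplex K (interval a k)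
  conclude (yes (j , a , full)) = a , Kf⊆K (interval a k) (j , inWindow)
    where
    inWindow : ∀ i → i ∈ interval a k → j ∈ window i
    inWindow i i∈ with interval-step a i∈
    ... | d , d<k , refl = full d<k
  conclude (no none) with floor-arithmetic n
  ... | e≤h , h+e≤n , k≤h+e , k+e≤n , k+h≤n+e = ⊥-elim
    (Chain.impossible constant (n / 4) (n / 2) k (m/n<m n 4 (from-yes (2 ≤? 4))) e≤h h+e≤n
      (m/n<m n 2 ≤-refl) k≤h+e k+e≤n k+h≤n+e (hit λ j a full → none (j , a , full)))
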